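{- Let $G$ be a graph. (i) If some connected component of $G$ has a degree sequence of cardinality $r>2$, then $K(H(G,x))\ge 2$. (ii) For each integer $r\ge 1$ there exists a graph $G$ whose degree sequence has cardinality $r$ and with $K(H(G,x))=1$.
   Context: All graphs are finite, simple and have no isolated vertices; $d_u$ is the degree of $u$. The harmonic polynomial is $H(G,x)=\sum_{uv\in E(G)}x^{d_u+d_v-1}$. For a polynomial $p$, $K(p(x))$ is the number of its non-zero coefficients. The degree sequence of a graph is the set of distinct vertex degree values, and its cardinality is the number of distinct vertex degrees. -}

module Defs where

open import Data.Fin.Base using (Fin)
open import Data.Fin.Properties using (_<?_)
open import Data.Fin.Subset using (Subset; Nonempty; _∈_)
open import Data.Fin.Subset.Properties using (_∈?_)
open import Data.List.Base
  using (List; []; _∷_; _++_; map; filter; foldr; length; lookup; replicate;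
         allFin; cartesianProduct; deduplicate)
open import Data.Nat.Base using (ℕ; _+_; _∸_)
open import Data.Nat.Properties using (_≟_)
open import Data.Product.Base using (∃; _×_; _,_)
open import Function.Bundles using (_⇔_)
open import Level using (0ℓ)
open import Relation.Binary.Construct.Closure.ReflexiveTransitive using (Star)
open import Relation.Binary.Core using (Rel)
open import Relation.Binary.Definitions using (Symmetric; Irreflexive; Decidable)
open import Relation.Binary.PropositionalEquality.Core using (_≡_)
open import Relation.Nullary.Decidable.Core using (¬?; _×-dec_)

record Graph : Set₁ where
  field
    order  : ℕ
    Adj    : Rel (Fin order) 0ℓ
    adj?   : Decidable Adj
    sym    : Symmetric Adj
    irrefl : Irreflexive _≡_ Adj

  Vertex : Set
  Vertex = Fin order

open Graph public using (order; Vertex)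

NoIsolatedVertices : Graph → Set
NoIsolatedVertices G = ∀ u → ∃ λ v → Graph.Adj G u v

degree : (G : Graph) → Vertex G → ℕ
degree G u = length (filter (Graph.adj? G u) (allFin (order G)))

degreeSequence : Graph → List ℕ
degreeSequence G = deduplicate _≟_ (map (degree G) (allFin (order G)))

-- Each unordered edge uv is listed once, as the pair with u < v.
edges : (G : Graph) → List (Vertex G × Vertex G)
edges G = filter (λ (u , v) → (u <? v) ×-dec Graph.adj? G u v)
                 (cartesianProduct (allFin (order G)) (allFin (order G)))

elements : ∀ {n} → Subset n → List (Fin n)
elements {n} C = filter (_∈? C) (allFin n)

-- The subgraph induced by C, its vertices renumbered in increasing order.
induced : (G : Graph) → Subset (order G) → Graph
induced G C = record
  { order  = length (elements C)
  ; Adj    = λ i j → Adj (vertex i) (vertex j)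
  ; adj?   = λ i j → adj? (vertex i) (vertex j)
  ; sym    = sym
  ; irrefl = λ { _≡_.refl → irrefl _≡_.refl }
  }
  where
  open Graph G using (Adj; adj?; sym; irrefl)
  vertex = lookup (elements C)

IsConnectedComponent : (G : Graph) → Subset (order G) → Set
IsConnectedComponent G C =
  Nonempty C × (∀ {u} → u ∈ C → ∀ v → v ∈ C ⇔ Star (Graph.Adj G) u v)

-- Coefficients in increasing degree; trailing zeros are allowed.  Natural
-- coefficients suffice since H(G,x) has no others.
Polynomial : Set
Polynomial = List ℕ

infixl 6 _⊕_

_⊕_ : Polynomial → Polynomial → Polynomial
[]       ⊕ q        = q
(a ∷ p)  ⊕ []       = a ∷ p
(a ∷ p)  ⊕ (b ∷ q)  = (a + b) ∷ (p ⊕ q)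

x^_ : ℕ → Polynomial
x^ k = replicate k 0 ++ 1 ∷ []

-- Endpoints of an edge have degree at least 1, so ∸ never truncates here.
H : Graph → Polynomial
H G = foldr _⊕_ [] (map (λ (u , v) → x^ (degree G u + degree G v ∸ 1)) (edges G))

K : Polynomial → ℕ
K p = length (filter (λ c → ¬? (c ≟ 0)) p)

{-# OPTIONS --safe #-}

-- Every edge uv contributes a positive coefficient at exponent d_u + d_v - 1, so
-- K(H(G,x)) < 2 forces a common value s of d_u + d_v over all edges.  Along a walk
-- the degree then alternates between d_u and s - d_u, so a component has at most
-- two distinct degrees.  Conversely, in a disjoint union of complete bipartite
-- graphs K_{a,s-a} with 1 ≤ a < s every edge has degree sum s, while all degrees
-- 1, ..., s - 1 occur; s = r + 1 gives the examples.
module Submission where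

open import Data.Fin.Base using (Fin; zero; suc; toℕ; fromℕ; fromℕ<; combine; remQuot)
open import Data.Fin.Properties
  using (_<?_; toℕ<n; toℕ-fromℕ; toℕ-fromℕ<; toℕ-injective;
         remQuot-combine; combine-remQuot; combine-injectiveʳ)
import Data.Fin.Properties as Fin
open import Data.Fin.Subset using (Subset) renaming (_∈_ to _∈ˢ_)
open import Data.Fin.Subset.Properties using (_∈?_)
open import Data.List.Base
  using (List; []; _∷_; _++_; map; filter; foldr; length; lookup; replicate;
         allFin; upTo; cartesianProduct)
open import Data.List.Membership.Propositional using (_∈_; lose)
open import Data.List.Membership.Propositional.Properties
  using (∈-filter⁺; ∈-filter⁻; ∈-map⁺; ∈-map⁻; ∈-allFin; ∈-lookup; ∈-upTo⁺; ∈-upTo⁻;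
         ∈-cartesianProduct⁺; ∈-deduplicate⁺; ∈-deduplicate⁻)
open import Data.List.Membership.Propositional.Properties.WithK using (unique∧set⇒bag)
open import Data.List.Properties
  using (length-map; length-tabulate; length-upTo; filter-some; filter-≐)
open import Data.List.Relation.Binary.BagAndSetEquality using (∼bag⇒↭)
open import Data.List.Relation.Binary.Permutation.Propositional.Properties using (↭-length)
open import Data.List.Relation.Unary.All as All using (All; []; _∷_; tabulate)
open import Data.List.Relation.Unary.AllPairs using ([]; _∷_)
open import Data.List.Relation.Unary.Any using (here; there; index)
open import Data.List.Relation.Unary.Any.Properties using (lookup-index)
open import Data.List.Relation.Unary.Unique.Propositional using (Unique)
import Data.List.Relation.Unary.Unique.DecPropositional.Properties as UniqueDec
import Data.List.Relation.Unary.Unique.Propositional.Properties as Unique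
open import Data.Nat.Base using (ℕ; zero; suc; _+_; _*_; _∸_; _≤_; _<_; _≥_; _>_; z≤n; s≤s; s≤s⁻¹)
open import Data.Nat.Properties
  using (+-identityʳ; _≟_; _≤?_; _≥?_; ≤-<-connex; ≤-trans; ≤-<-trans; m≤n⇒m≤1+n; ≰⇒>;
         <⇒≱; <⇒≤; suc-injective; +-comm; +-suc; +-cancelˡ-≡; +-∸-assoc; m∸n+n≡m; m+n∸m≡n;
         m+[n∸m]≡n; m∸n≤m; m≤m+n; m+n≡0⇒m≡0; m+n≡0⇒n≡0)
  renaming (_<?_ to _<ⁿ?_)
open import Data.Product.Base using (∃; _×_; _,_; proj₁; proj₂; uncurry)
open import Data.Sum.Base using (_⊎_; inj₁; inj₂)
open import Function.Base using (_∘_; id)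
open import Function.Bundles using (mk⇔; Equivalence)
open import Relation.Binary.Construct.Closure.ReflexiveTransitive using (Star; ε; _◅_)
open import Relation.Binary.Definitions using (tri<; tri≈; tri>)
open import Relation.Binary.PropositionalEquality
  using (_≡_; _≢_; refl; sym; trans; cong; subst; module ≡-Reasoning)
open import Relation.Nullary using (¬_; yes; no; contradiction)
open import Relation.Nullary.Decidable using (_×-dec_; _⊎-dec_)
open import Relation.Unary using (Decidable)
open import Defs

-- Counting in duplicate-free lists.

module _ {A : Set} where

  -- Without duplicates, equality as sets is equality as bags, so the lists are permutations of each
  -- other. Degrees are computed below by exhibiting a neighbour list in a second form.
  unique∧set⇒length : {xs ys : List A} → Unique xs → Unique ys →
                      (∀ {x} → x ∈ xs → x ∈ ys) → (∀ {x} → x ∈ ys → x ∈ xs) →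
                      length xs ≡ length ys
  unique∧set⇒length !xs !ys xs⊆ys ys⊆xs = ↭-length (∼bag⇒↭ (unique∧set⇒bag !xs !ys (mk⇔ xs⊆ys ys⊆xs)))

  -- The complement is a predicate `Q` with its own decision procedure, so that `j ≤ m` and `m < j`
  -- fit without rewriting a negation.
  length-filter+∁ : {P Q : A → Set} (P? : Decidable P) (Q? : Decidable Q) →
                    (∀ {x} → P x → ¬ Q x) → (∀ {x} → ¬ P x → Q x) → (xs : List A) →
                    length (filter P? xs) + length (filter Q? xs) ≡ length xs
  length-filter+∁ P? Q? P⇒¬Q ¬P⇒Q [] = refl
  length-filter+∁ P? Q? P⇒¬Q ¬P⇒Q (x ∷ xs) with P? x | Q? x
  ... | yes p | yes q = contradiction q (P⇒¬Q p)
  ... | yes p | no _  = cong suc (length-filter+∁ P? Q? P⇒¬Q ¬P⇒Q xs)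
  ... | no _  | yes _ = trans (+-suc _ _) (cong suc (length-filter+∁ P? Q? P⇒¬Q ¬P⇒Q xs))
  ... | no ¬p | no ¬q = contradiction (¬P⇒Q ¬p) ¬q

  -- Pigeonhole: among the first three entries two would coincide.
  unique-pair⇒length≤2 : {a b : A} {xs : List A} → Unique xs →
                         (∀ {x} → x ∈ xs → x ≡ a ⊎ x ≡ b) → length xs ≤ 2
  unique-pair⇒length≤2 {xs = []}          _ _ = z≤n
  unique-pair⇒length≤2 {xs = _ ∷ []}      _ _ = s≤s z≤n
  unique-pair⇒length≤2 {xs = _ ∷ _ ∷ []}  _ _ = s≤s (s≤s z≤n)
  unique-pair⇒length≤2 {xs = _ ∷ _ ∷ _ ∷ _} ((x≢y ∷ x≢z ∷ _) ∷ (y≢z ∷ _) ∷ _) ∈ab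
    with ∈ab (here refl) | ∈ab (there (here refl)) | ∈ab (there (there (here refl)))
  ... | inj₁ refl | inj₁ refl | _         = contradiction refl x≢y
  ... | inj₁ refl | inj₂ refl | inj₁ refl = contradiction refl x≢z
  ... | inj₁ refl | inj₂ refl | inj₂ refl = contradiction refl y≢z
  ... | inj₂ refl | inj₂ refl | _         = contradiction refl x≢y
  ... | inj₂ refl | inj₁ refl | inj₁ refl = contradiction refl y≢z
  ... | inj₂ refl | inj₁ refl | inj₂ refl = contradiction refl x≢z

allFin-! : ∀ n → Unique (allFin n)
allFin-! n = Unique.tabulate⁺ id

lookup-injective : {A : Set} {xs : List A} → Unique xs →
                   ∀ {i j} → lookup xs i ≡ lookup xs j → i ≡ j
lookup-injective (_ ∷ _)   {zero}  {zero}  _  = refl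
lookup-injective {xs = _ ∷ xs} (x∉ ∷ _) {zero} {suc j} eq =
  contradiction eq (All.lookup x∉ (∈-lookup {xs = xs} j))
lookup-injective {xs = _ ∷ xs} (x∉ ∷ _) {suc i} {zero} eq =
  contradiction (sym eq) (All.lookup x∉ (∈-lookup {xs = xs} i))
lookup-injective (_ ∷ !xs) {suc i} {suc j} eq = cong suc (lookup-injective !xs eq)

-- Coefficients of sums of monomials.

coeff : Polynomial → ℕ → ℕ
coeff []      _       = 0
coeff (a ∷ _) zero    = a
coeff (_ ∷ p) (suc k) = coeff p k

coeff-⊕ : ∀ p q k → coeff (p ⊕ q) k ≡ coeff p k + coeff q k
coeff-⊕ []      q       k       = refl
coeff-⊕ (a ∷ p) []      k       = sym (+-identityʳ _)
coeff-⊕ (a ∷ p) (b ∷ q) zero    = refl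
coeff-⊕ (a ∷ p) (b ∷ q) (suc k) = coeff-⊕ p q k

coeff-x^ : ∀ k → coeff (x^ k) k ≡ 1
coeff-x^ zero    = refl
coeff-x^ (suc k) = coeff-x^ k

coeff≢0⇒K≥1 : ∀ p k → coeff p k ≢ 0 → K p ≥ 1
coeff≢0⇒K≥1 []            k       c≢0 = contradiction refl c≢0
coeff≢0⇒K≥1 (zero ∷ p)    zero    c≢0 = contradiction refl c≢0
coeff≢0⇒K≥1 (suc _ ∷ p)   _       _   = s≤s z≤n
coeff≢0⇒K≥1 (zero ∷ p)    (suc k) c≢0 = coeff≢0⇒K≥1 p k c≢0

-- Zero heads are stripped, lowering both positions. At the first non-zero head, which counts once,
-- at least one of the distinct positions lies in the tail and yields a second non-zero coefficient.
coeffs≢0⇒K≥2 : ∀ p {k l} → k ≢ l → coeff p k ≢ 0 → coeff p l ≢ 0 → K p ≥ 2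
coeffs≢0⇒K≥2 []                          _   c≢0 _   = contradiction refl c≢0
coeffs≢0⇒K≥2 (_ ∷ _)     {zero}  {zero}  k≢l _   _   = contradiction refl k≢l
coeffs≢0⇒K≥2 (zero ∷ _)  {zero}          _   c≢0 _   = contradiction refl c≢0
coeffs≢0⇒K≥2 (zero ∷ _)  {suc _} {zero}  _   _   d≢0 = contradiction refl d≢0
coeffs≢0⇒K≥2 (zero ∷ p)  {suc _} {suc _} k≢l c≢0 d≢0 = coeffs≢0⇒K≥2 p (k≢l ∘ cong suc) c≢0 d≢0
coeffs≢0⇒K≥2 (suc _ ∷ p) {zero}  {suc l} _   _   d≢0 = s≤s (coeff≢0⇒K≥1 p l d≢0)
coeffs≢0⇒K≥2 (suc _ ∷ p) {suc k} {_}     _   c≢0 _   = s≤s (coeff≢0⇒K≥1 p k c≢0)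

module _ {A : Set} (f : A → ℕ) where

  -- Nothing cancels: a sum of natural numbers vanishes only if both summands do.
  coeff-sum≢0 : ∀ {e es} → e ∈ es → coeff (foldr _⊕_ [] (map (λ e → x^ (f e)) es)) (f e) ≢ 0
  coeff-sum≢0 {es = e ∷ es} (here refl) c≡0
    with () ← trans (sym (coeff-x^ (f e)))
                (m+n≡0⇒m≡0 _ (trans (sym (coeff-⊕ (x^ f e) _ (f e))) c≡0))
  coeff-sum≢0 {e} {d ∷ es} (there e∈es) c≡0 =
    coeff-sum≢0 e∈es (m+n≡0⇒n≡0 (coeff (x^ f d) (f e)) (trans (sym (coeff-⊕ (x^ f d) _ (f e))) c≡0))

  -- This is equality of lists, not just of coefficients; the empty sum would be `[]` rather than a
  -- row of zeros.
  sum-x^-constant : ∀ {k es} → All (λ e → f e ≡ k) es → 0 < length es →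
    foldr _⊕_ [] (map (λ e → x^ (f e)) es) ≡ replicate k 0 ++ length es ∷ []
  sum-x^-constant {k} (refl ∷ []) _ = x^⊕[] k
    where
    x^⊕[] : ∀ k → x^ k ⊕ [] ≡ x^ k
    x^⊕[] zero    = refl
    x^⊕[] (suc k) = refl
  sum-x^-constant {k} (refl ∷ ps@(_ ∷ _)) _ =
    trans (cong (x^ k ⊕_) (sum-x^-constant ps (s≤s z≤n))) (x^⊕ k _)
    where
    x^⊕ : ∀ k c → x^ k ⊕ (replicate k 0 ++ c ∷ []) ≡ replicate k 0 ++ suc c ∷ []
    x^⊕ zero    c = refl
    x^⊕ (suc k) c = cong (0 ∷_) (x^⊕ k c)

K-monomial : ∀ k {c} → 0 < c → K (replicate k 0 ++ c ∷ []) ≡ 1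
K-monomial zero    (s≤s _) = refl
K-monomial (suc k) 0<c     = K-monomial k 0<c

-- Degree sums along edges and walks, and degrees within a component.

module _ (G : Graph) where
  open Graph G using (Adj; adj?)

  adj⇒∈edges : ∀ {u v} → Adj u v → (u , v) ∈ edges G ⊎ (v , u) ∈ edges G
  adj⇒∈edges {u} {v} uv with Fin.<-cmp u v
  ... | tri< u<v _ _ = inj₁ (∈-filter⁺ _ (∈-cartesianProduct⁺ (∈-allFin u) (∈-allFin v)) (u<v , uv))
  ... | tri≈ _ u≡v _ = contradiction uv (Graph.irrefl G u≡v)
  ... | tri> _ _ v<u = inj₂ (∈-filter⁺ _ (∈-cartesianProduct⁺ (∈-allFin v) (∈-allFin u))
                                         (v<u , Graph.sym G uv))

  degree>0 : ∀ {u v} → Adj u v → 0 < degree G u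
  degree>0 {u} {v} uv = filter-some (adj? u) (lose (∈-allFin v) uv)

  exponent : Vertex G × Vertex G → ℕ
  exponent (u , v) = degree G u + degree G v ∸ 1

  adj⇒coeff≢0 : ∀ {u v} → Adj u v → coeff (H G) (exponent (u , v)) ≢ 0
  adj⇒coeff≢0 {u} {v} uv with adj⇒∈edges uv
  ... | inj₁ e∈ = coeff-sum≢0 exponent e∈
  ... | inj₂ e∈ = subst (λ s → coeff (H G) (s ∸ 1) ≢ 0) (+-comm (degree G v) (degree G u))
                        (coeff-sum≢0 exponent e∈)

  -- Different exponents would give two non-zero coefficients. Equal exponents give equal sums
  -- because endpoints have positive degree, so `∸ 1` does not truncate.
  K<2⇒degree-sum-constant : ¬ K (H G) ≥ 2 → ∀ {u v x y} → Adj u v → Adj x y →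
                            degree G u + degree G v ≡ degree G x + degree G y
  K<2⇒degree-sum-constant K≱2 {u} {v} {x} {y} uv xy
    with exponent (u , v) ≟ exponent (x , y)
  ... | no  ≢exp = contradiction (coeffs≢0⇒K≥2 (H G) ≢exp (adj⇒coeff≢0 uv) (adj⇒coeff≢0 xy)) K≱2
  ... | yes ≡exp = pred-injective (≤-trans (degree>0 uv) (m≤m+n _ _))
                                  (≤-trans (degree>0 xy) (m≤m+n _ _)) ≡exp
    where
    pred-injective : ∀ {m n} → 0 < m → 0 < n → m ∸ 1 ≡ n ∸ 1 → m ≡ n
    pred-injective (s≤s _) (s≤s _) = cong suc

  -- Cancelling the known degree in the edge sum `a + b` shows that each step swaps the values `a`
  -- and `b`.
  degree-walk : ∀ {a b} → (∀ {x y} → Adj x y → degree G x + degree G y ≡ a + b) →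
                ∀ {x y} → Star Adj x y → degree G x ≡ a ⊎ degree G x ≡ b →
                degree G y ≡ a ⊎ degree G y ≡ b
  degree-walk {a} {b} sum ε            dx = dx
  degree-walk {a} {b} sum (xz ◅ zy) (inj₁ refl) =
    degree-walk sum zy (inj₂ (+-cancelˡ-≡ a _ _ (sum xz)))
  degree-walk {a} {b} sum (xz ◅ zy) (inj₂ refl) =
    degree-walk sum zy (inj₁ (+-cancelˡ-≡ b _ _ (trans (sum xz) (+-comm a b))))

  module _ {C : Subset (order G)} (component : IsConnectedComponent G C) where

    private
      vertex : Vertex (induced G C) → Vertex G
      vertex = lookup (elements C)

      vertex∈C : ∀ i → vertex i ∈ˢ C
      vertex∈C i = proj₂ (∈-filter⁻ (_∈? C) {xs = allFin (order G)} (∈-lookup {xs = elements C} i))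

    -- A component is closed under adjacency, so no neighbour is lost on passing to the induced
    -- subgraph; `vertex` maps the neighbours there bijectively onto those in `G`.
    degree-component : ∀ i → degree (induced G C) i ≡ degree G (vertex i)
    degree-component i = trans (sym (length-map vertex neighbours))
      (unique∧set⇒length
        (Unique.map⁺ (lookup-injective !elements) (Unique.filter⁺ _ (allFin-! _)))
        (Unique.filter⁺ _ (allFin-! _)) to from)
      where
      neighbours : List (Vertex (induced G C))
      neighbours = filter (λ j → adj? (vertex i) (vertex j)) (allFin _)

      !elements : Unique (elements C)
      !elements = Unique.filter⁺ (_∈? C) (allFin-! _)

      to : ∀ {v} → v ∈ map vertex neighbours →
           v ∈ filter (adj? (vertex i)) (allFin _)
      to v∈ with j , j∈ , refl ← ∈-map⁻ vertex v∈ =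
        ∈-filter⁺ (adj? (vertex i)) (∈-allFin _)
          (proj₂ (∈-filter⁻ (λ j → adj? (vertex i) (vertex j)) {xs = allFin _} j∈))

      from : ∀ {v} → v ∈ filter (adj? (vertex i)) (allFin _) →
             v ∈ map vertex neighbours
      from {v} v∈ = subst (_∈ _) (sym v≡)
        (∈-map⁺ vertex (∈-filter⁺ _ (∈-allFin (index v∈elements)) (subst (Adj _) v≡ iv)))
        where
        iv : Adj (vertex i) v
        iv = proj₂ (∈-filter⁻ (adj? (vertex i)) {xs = allFin _} v∈)
        -- The edge from `vertex i` to `v` is a walk of length one, which puts `v` into `C`.
        v∈elements : v ∈ elements C
        v∈elements = ∈-filter⁺ (_∈? C) (∈-allFin v)
          (Equivalence.from (proj₂ component (vertex∈C i) v) (iv ◅ ε))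
        v≡ : v ≡ vertex (index v∈elements)
        v≡ = lookup-index v∈elements

    component-degrees≤2 : NoIsolatedVertices G → ¬ K (H G) ≥ 2 →
                          length (degreeSequence (induced G C)) ≤ 2
    component-degrees≤2 noIsolated K≱2 =
      unique-pair⇒length≤2 (UniqueDec.deduplicate-! _≟_ _) two-degrees
      where
      -- The two candidate degrees are those of the ends of one edge `uw` starting in `C`; walks
      -- from `u` reach all of `C`.
      u    = proj₁ (proj₁ component)
      u∈C  = proj₂ (proj₁ component)
      w    = proj₁ (noIsolated u)
      uw   = proj₂ (noIsolated u)

      two-degrees : ∀ {d} → d ∈ degreeSequence (induced G C) → d ≡ degree G u ⊎ d ≡ degree G w
      two-degrees d∈ with i , _ , refl ← ∈-map⁻ (degree (induced G C)) (∈-deduplicate⁻ _≟_ _ d∈) =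
        subst (λ d → d ≡ degree G u ⊎ d ≡ degree G w) (sym (degree-component i))
          (degree-walk (λ xy → K<2⇒degree-sum-constant K≱2 xy uw)
            (Equivalence.to (proj₂ component u∈C (vertex i)) (vertex∈C i)) (inj₁ refl))

  -- All edges contribute the same monomial, so the polynomial is the number of edges times `x^ k`,
  -- and the given edge makes that number positive.
  K≡1 : ∀ {k} → (∀ {u v} → Adj u v → degree G u + degree G v ≡ suc k) →
        ∃ (uncurry Adj) → K (H G) ≡ 1
  K≡1 {k} sum ((u , v) , uv) = trans (cong K (sum-x^-constant exponent (tabulate exponent≡k) edges>0))
                                     (K-monomial k edges>0)
    where
    exponent≡k : ∀ {e} → e ∈ edges G → exponent e ≡ k
    exponent≡k e∈ = cong (_∸ 1) (sum (proj₂ (proj₂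
      (∈-filter⁻ (λ (u , v) → (u <? v) ×-dec adj? u v)
      {xs = cartesianProduct (allFin _) (allFin _)} e∈))))

    ∈⇒length>0 : ∀ {A : Set} {x : A} {xs} → x ∈ xs → 0 < length xs
    ∈⇒length>0 (here _)  = s≤s z≤n
    ∈⇒length>0 (there _) = s≤s z≤n

    edges>0 : 0 < length (edges G)
    edges>0 with adj⇒∈edges uv
    ... | inj₁ e∈ = ∈⇒length>0 e∈
    ... | inj₂ e∈ = ∈⇒length>0 e∈

-- Sizes of the two sides of a complete bipartite graph on `Fin n` split at `m`.

module _ (m n : ℕ) where

  atMost : List (Fin n)
  atMost = filter (λ j → toℕ j ≤? m) (allFin n)

  above : List (Fin n)
  above = filter (λ j → m <ⁿ? toℕ j) (allFin n)

  -- The hypothesis ensures that all of 0, ..., `m` occur in `Fin n`, so `toℕ` carries the list onto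
  -- `upTo (suc m)`.
  length-atMost : m < n → length atMost ≡ suc m
  length-atMost m<n = begin
    length atMost            ≡⟨ length-map toℕ atMost ⟨
    length (map toℕ atMost)  ≡⟨ unique∧set⇒length
                                  (Unique.map⁺ toℕ-injective (Unique.filter⁺ _ (allFin-! n)))
                                  (Unique.upTo⁺ (suc m)) to from ⟩
    length (upTo (suc m))    ≡⟨ length-upTo (suc m) ⟩
    suc m                    ∎
    where
    open ≡-Reasoning

    to : ∀ {k} → k ∈ map toℕ atMost → k ∈ upTo (suc m)
    to k∈ with j , j∈ , refl ← ∈-map⁻ toℕ k∈ =
      ∈-upTo⁺ (s≤s (proj₂ (∈-filter⁻ (λ j → toℕ j ≤? m) {xs = allFin n} j∈)))

    from : ∀ {k} → k ∈ upTo (suc m) → k ∈ map toℕ atMost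
    from {k} k∈ = subst (_∈ _) (toℕ-fromℕ< k<n)
      (∈-map⁺ toℕ (∈-filter⁺ _ (∈-allFin (fromℕ< k<n)) (subst (_≤ m) (sym (toℕ-fromℕ< k<n)) k≤m)))
      where
      k≤m = s≤s⁻¹ (∈-upTo⁻ k∈)
      k<n = ≤-<-trans k≤m m<n

  length-above : m < n → length above ≡ n ∸ suc m
  length-above m<n = trans (sym (m+n∸m≡n (suc m) (length above))) (cong (_∸ suc m) (begin
    suc m + length above          ≡⟨ cong (_+ length above) (length-atMost m<n) ⟨
    length atMost + length above  ≡⟨ length-filter+∁ (λ j → toℕ j ≤? m) (λ j → m <ⁿ? toℕ j)
                                       (λ j≤m m<j → <⇒≱ m<j j≤m) ≰⇒> (allFin n) ⟩
    length (allFin n)             ≡⟨ length-tabulate (id {A = Fin n}) ⟩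
    n                             ∎))
    where open ≡-Reasoning

-- The disjoint union of complete bipartite graphs.

-- Each K_{i+1,r-i} with i < r has r + 1 vertices, so the vertices of their union
-- are pairs (i , j); such a vertex lies on the side of size i + 1 iff j ≤ i.
module BipartiteUnion (r : ℕ) where

  private
    V : Set
    V = Fin (r * suc r)

  copy : V → Fin r
  copy v = proj₁ (remQuot {r} (suc r) v)

  position : V → Fin (suc r)
  position v = proj₂ (remQuot {r} (suc r) v)

  Opposite : Fin r → Fin (suc r) → Fin (suc r) → Set
  Opposite i j k = (toℕ j ≤ toℕ i × toℕ i < toℕ k) ⊎ (toℕ i < toℕ j × toℕ k ≤ toℕ i)

  opposite? : ∀ i j → Decidable (Opposite i j)
  opposite? i j k = (_ ≤? _ ×-dec _ <ⁿ? _) ⊎-dec (_ <ⁿ? _ ×-dec _ ≤? _)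

  graph : Graph
  graph = record
    { order  = r * suc r
    ; Adj    = λ u v → copy u ≡ copy v × Opposite (copy u) (position u) (position v)
    ; adj?   = λ u v → (copy u Fin.≟ copy v) ×-dec opposite? (copy u) (position u) (position v)
    ; sym    = λ { {u} {v} (eq , opp) → sym eq ,
                   subst (λ i → Opposite i (position v) (position u)) eq (opposite-sym opp) }
    ; irrefl = λ { refl (_ , inj₁ (j≤i , i<j)) → <⇒≱ i<j j≤i
                 ; refl (_ , inj₂ (i<j , j≤i)) → <⇒≱ i<j j≤i }
    }
    where
    opposite-sym : ∀ {i j k} → Opposite i j k → Opposite i k j
    opposite-sym (inj₁ (p , q)) = inj₂ (q , p)
    opposite-sym (inj₂ (p , q)) = inj₁ (q , p)

  open Graph graph using (Adj; adj?)

  copy-combine : ∀ i j → copy (combine i j) ≡ i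
  copy-combine i j = cong proj₁ (remQuot-combine i j)

  position-combine : ∀ i j → position (combine i j) ≡ j
  position-combine i j = cong proj₂ (remQuot-combine {r} i j)

  adj-combine : ∀ u {k} → Opposite (copy u) (position u) k → Adj u (combine (copy u) k)
  adj-combine u {k} opp = sym (copy-combine _ k) ,
    subst (Opposite _ _) (sym (position-combine (copy u) k)) opp

  -- Neighbours stay in the copy of `u`, where `combine (copy u)` is injective, so it suffices to
  -- count positions.
  degree-graph : ∀ u → degree graph u ≡
                 length (filter (opposite? (copy u) (position u)) (allFin (suc r)))
  degree-graph u = trans
    (unique∧set⇒length (Unique.filter⁺ (adj? u) (allFin-! _))
      (Unique.map⁺ (λ {j} {k} → combine-injectiveʳ (copy u) j (copy u) k)
        (Unique.filter⁺ opp? (allFin-! _)))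
      to from)
    (length-map (combine (copy u)) (filter opp? (allFin _)))
    where
    opp? = opposite? (copy u) (position u)
    to : ∀ {v} → v ∈ filter (adj? u) (allFin _) → v ∈ map (combine (copy u)) (filter opp? (allFin _))
    to {v} v∈ with same , opp ← proj₂ (∈-filter⁻ (adj? u) {xs = allFin _} v∈) =
      subst (_∈ _) (trans (cong (λ i → combine i (position v)) same) (combine-remQuot {r} (suc r) v))
        (∈-map⁺ (combine (copy u)) (∈-filter⁺ opp? (∈-allFin _) opp))
    from : ∀ {v} → v ∈ map (combine (copy u)) (filter opp? (allFin _)) → v ∈ filter (adj? u) (allFin _)
    from v∈ with k , k∈ , refl ← ∈-map⁻ (combine (copy u)) v∈ =
      ∈-filter⁺ (adj? u) (∈-allFin _) (adj-combine u (proj₂ (∈-filter⁻ opp? {xs = allFin _} k∈)))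

  copy≤r : ∀ u → toℕ (copy u) < suc r
  copy≤r u = m≤n⇒m≤1+n (toℕ<n (copy u))

  -- Such a vertex sees exactly the positions beyond `copy u`; their number `suc r ∸ suc i` reduces
  -- to `r ∸ i`.
  degree-≤ : ∀ u → toℕ (position u) ≤ toℕ (copy u) → degree graph u ≡ r ∸ toℕ (copy u)
  degree-≤ u j≤i = begin
    degree graph u                          ≡⟨ degree-graph u ⟩
    _                                       ≡⟨ cong length (filter-≐
                                                 (opposite? (copy u) (position u))
                                                 (λ k → toℕ (copy u) <ⁿ? toℕ k)
                                                 (to , λ i<k → inj₁ (j≤i , i<k))
                                                 (allFin (suc r))) ⟩
    length (above (toℕ (copy u)) (suc r))   ≡⟨ length-above _ _ (copy≤r u) ⟩
    r ∸ toℕ (copy u)                        ∎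
    where
    open ≡-Reasoning
    to : ∀ {k} → Opposite (copy u) (position u) k → toℕ (copy u) < toℕ k
    to (inj₁ (_ , i<k)) = i<k
    to (inj₂ (i<j , _)) = contradiction j≤i (<⇒≱ i<j)

  degree-> : ∀ u → toℕ (copy u) < toℕ (position u) → degree graph u ≡ suc (toℕ (copy u))
  degree-> u i<j = begin
    degree graph u                          ≡⟨ degree-graph u ⟩
    _                                       ≡⟨ cong length (filter-≐
                                                 (opposite? (copy u) (position u))
                                                 (λ k → toℕ k ≤? toℕ (copy u))
                                                 (to , λ k≤i → inj₂ (i<j , k≤i))
                                                 (allFin (suc r))) ⟩
    length (atMost (toℕ (copy u)) (suc r))  ≡⟨ length-atMost _ _ (copy≤r u) ⟩
    suc (toℕ (copy u))                      ∎
    where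
    open ≡-Reasoning
    to : ∀ {k} → Opposite (copy u) (position u) k → toℕ k ≤ toℕ (copy u)
    to (inj₁ (j≤i , _)) = contradiction j≤i (<⇒≱ i<j)
    to (inj₂ (_ , k≤i)) = k≤i

  degree-sum : ∀ {u v} → Adj u v → degree graph u + degree graph v ≡ suc r
  degree-sum {u} {v} (same , inj₁ (j≤i , i<k))
    -- The ends lie on opposite sides of one copy `i`, with degrees `r ∸ i` and `suc i`.
    rewrite degree-≤ u j≤i | degree-> v (subst (λ i → toℕ i < _) same i<k) | same =
    trans (+-suc _ _) (cong suc (m∸n+n≡m (<⇒≤ (toℕ<n (copy v)))))
  degree-sum {u} {v} (same , inj₂ (i<j , k≤i))
    rewrite degree-> u i<j | degree-≤ v (subst (λ i → _ ≤ toℕ i) same k≤i) | same =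
    cong suc (m+[n∸m]≡n (<⇒≤ (toℕ<n (copy v))))

  i<last : (i : Fin r) → toℕ i < toℕ (fromℕ r)
  i<last i = subst (toℕ i <_) (sym (toℕ-fromℕ r)) (toℕ<n i)

  -- In every copy, position 0 and the last position `r` lie on opposite sides, so each vertex is
  -- adjacent to one of them.
  noIsolated : NoIsolatedVertices graph
  noIsolated u with ≤-<-connex (toℕ (position u)) (toℕ (copy u))
  ... | inj₁ j≤i = _ , adj-combine u (inj₁ (j≤i , i<last (copy u)))
  ... | inj₂ i<j = _ , adj-combine u {zero} (inj₂ (i<j , z≤n))

  -- The degrees that occur are exactly 1, ..., `r`, listed as `map suc (upTo r)`.
  length-degreeSequence : length (degreeSequence graph) ≡ r
  length-degreeSequence = begin
    length (degreeSequence graph)  ≡⟨ unique∧set⇒length (UniqueDec.deduplicate-! _≟_ _)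
                                        (Unique.map⁺ suc-injective (Unique.upTo⁺ r)) to from ⟩
    length (map suc (upTo r))      ≡⟨ length-map suc (upTo r) ⟩
    length (upTo r)                ≡⟨ length-upTo r ⟩
    r                              ∎
    where
    open ≡-Reasoning

    degree∈ : ∀ u → degree graph u ∈ map suc (upTo r)
    degree∈ u with ≤-<-connex (toℕ (position u)) (toℕ (copy u))
    ... | inj₂ i<j = subst (_∈ _) (sym (degree-> u i<j)) (∈-map⁺ suc (∈-upTo⁺ (toℕ<n (copy u))))
    ... | inj₁ j≤i = subst (_∈ _) (sym (trans (degree-≤ u j≤i) r∸i≡))
                      (∈-map⁺ suc (∈-upTo⁺ (subst (_≤ r) r∸i≡ (m∸n≤m r (toℕ (copy u))))))
      where
      -- Written as a successor, the degree is visibly positive; the same equation bounds its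
      -- predecessor below `r`.
      r∸i≡ : r ∸ toℕ (copy u) ≡ suc (r ∸ suc (toℕ (copy u)))
      r∸i≡ = +-∸-assoc 1 (toℕ<n (copy u))

    to : ∀ {d} → d ∈ degreeSequence graph → d ∈ map suc (upTo r)
    to d∈ with u , _ , refl ← ∈-map⁻ (degree graph) (∈-deduplicate⁻ _≟_ _ d∈) = degree∈ u

    from : ∀ {d} → d ∈ map suc (upTo r) → d ∈ degreeSequence graph
    from d∈ with t , t∈ , refl ← ∈-map⁻ suc d∈ =
      ∈-deduplicate⁺ _≟_ (subst (_∈ _) degree≡ (∈-map⁺ (degree graph) (∈-allFin u)))
      where
      -- Degree `suc t` is attained in copy `t` by the last position, which sees the positions 0,
      -- ..., `t`.
      i = fromℕ< (∈-upTo⁻ t∈)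
      u = combine i (fromℕ r)
      degree≡ : degree graph u ≡ suc t
      degree≡ = trans
        (degree-> u (subst (λ j → toℕ (copy u) < toℕ j) (sym (position-combine i _)) (i<last (copy u))))
        (cong suc (trans (cong toℕ (copy-combine i _)) (toℕ-fromℕ< _)))

  K-graph : r ≥ 1 → K (H graph) ≡ 1
  -- Since `r ≥ 1`, copy 0 exists, and its vertex at position 0 supplies an edge.
  K-graph r≥1 = K≡1 graph degree-sum (_ , proj₂ (noIsolated (combine (fromℕ< r≥1) zero)))

theorem17 : ((G : Graph) → NoIsolatedVertices G →
    (∃ λ C → IsConnectedComponent G C ×
    length (degreeSequence (induced G C)) > 2) →
    K (H G) ≥ 2)
    ×
    (∀ (r : ℕ) → r ≥ 1 →
    ∃ λ (G : Graph) → NoIsolatedVertices G ×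
    length (degreeSequence G) ≡ r ×
    K (H G) ≡ 1)
theorem17 = K≥2 , λ r r≥1 → let open BipartiteUnion r in
  graph , noIsolated , length-degreeSequence , K-graph r≥1
  where
  K≥2 : (G : Graph) → NoIsolatedVertices G →
        (∃ λ C → IsConnectedComponent G C × length (degreeSequence (induced G C)) > 2) →
        K (H G) ≥ 2
  K≥2 G noIsolated (C , component , >2) with K (H G) ≥? 2
  ... | yes K≥2 = K≥2
  ... | no  K≱2 = contradiction (component-degrees≤2 G component noIsolated K≱2) (<⇒≱ >2)
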